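{- On rooted plane trees, the map $M$ given by the recursion $$M([\,])=[\,],\qquad M([c_1,\dots,c_k])=M(c_1)\oplus\lambda\bigl(M([c_2,\dots,c_k])\bigr)\quad(k\ge 1)$$ coincides with Donaghey's automorphism $L^{ -1}\circ R$ on plane trees.
   Context: A rooted plane tree is represented as the list $[c_1,\dots,c_k]$ of the subtrees hanging from its root; the single-node tree is $e=[\,]$. Operations: $\lambda(T)=[T]$ (new root with $T$ as sole child) and $\oplus$ concatenates the child lists of the two roots, so $[c_1,\dots,c_k]=\lambda(c_1)\oplus\cdots\oplus\lambda(c_k)$. Donaghey's automorphism is $L^{ -1}\circ R$, where $R$ and $L$ are maps from "general bracketings" to "plus-binary bracketings". A general bracketing is identified with a plane tree in the usual way, and $[c_1,\dots,c_k]$ represents $\lambda(c_1)\oplus\cdots\oplus\lambda(c_k)$. A plus-binary bracketing is represented as a (possibly empty) list $[b_1,\dots,b_k]$, each $b_i$ itself a plus-binary bracketing. The map $R$ sends the general bracketing $[c_1,\dots,c_k]$ to the plus-binary bracketing $[R(c_1),\dots,R(c_k)]$ (with $R([\,])=[\,]$). The map $L^{ -1}$ converts a plus-binary bracketing to a general bracketing (plane tree) by decoding it, recursively, in right-nested fashion: $L^{ -1}([\,])=e$ and $$L^{ -1}([b_1,\dots,b_k])=L^{ -1}(b_1)\oplus\lambda\bigl(L^{ -1}(b_2)\oplus\lambda(\cdots\oplus\lambda(L^{ -1}(b_k)\oplus\lambda(e))\cdots)\bigr).$$ -}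

module Defs where

open import Data.List using (List; []; _∷_; _++_; foldr)

data PlaneTree : Set where
  node : List PlaneTree → PlaneTree

e : PlaneTree
e = node []

-- The operation written λ in the mathematics (λ is reserved in Agda).
Λ : PlaneTree → PlaneTree
Λ t = node (t ∷ [])

infixr 5 _⊕_

_⊕_ : PlaneTree → PlaneTree → PlaneTree
node cs ⊕ node ds = node (cs ++ ds)

M : PlaneTree → PlaneTree
M (node [])       = node []
M (node (c ∷ cs)) = M c ⊕ Λ (M (node cs))

-- Plus-binary bracketings.  They have the same shape as plane trees, which
-- stand for general bracketings, but a list of subterms is decoded differently
-- (see rightNested), so the two are kept as separate types.
data PlusBinary : Set where
  plus : List PlusBinary → PlusBinary

-- R* and L⁻¹* are the maps R and L⁻¹ applied to each entry of a list; they are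
-- spelled out because the termination checker does not see through List.map.
mutual
  R : PlaneTree → PlusBinary
  R (node cs) = plus (R* cs)

  R* : List PlaneTree → List PlusBinary
  R* []       = []
  R* (c ∷ cs) = R c ∷ R* cs

-- rightNested [t₁,…,tₖ] = t₁ ⊕ Λ (t₂ ⊕ Λ (⋯ ⊕ Λ (tₖ ⊕ Λ e)⋯)), and e if k = 0.
rightNested : List PlaneTree → PlaneTree
rightNested = foldr (λ t s → t ⊕ Λ s) e

mutual
  L⁻¹ : PlusBinary → PlaneTree
  L⁻¹ (plus bs) = rightNested (L⁻¹* bs)

  L⁻¹* : List PlusBinary → List PlaneTree
  L⁻¹* []       = []
  L⁻¹* (b ∷ bs) = L⁻¹ b ∷ L⁻¹* bs

{-# OPTIONS --safe #-}
module Submission where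

open import Defs
open import Data.List using ([]; _∷_)
open import Relation.Binary.PropositionalEquality using (_≡_; refl; cong; cong₂)

-- Both sides obey one recursion: `R` acts entrywise, and the tail of a right-nested fold decodes
-- the remaining list, so `L⁻¹ ∘ R` splits off the first child just as `M` does.

theorem5p8 : ∀ (t : PlaneTree) → M t ≡ L⁻¹ (R t)
theorem5p8 (node [])       = refl
-- The right side computes to `L⁻¹ (R c) ⊕ Λ (L⁻¹ (R (node cs)))`; the induction hypotheses are for
-- the first child and for the tree with that child removed.
theorem5p8 (node (c ∷ cs)) = cong₂ _⊕_ (theorem5p8 c) (cong Λ (theorem5p8 (node cs)))
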